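{- Let $\alpha=(\alpha_1,\dots,\alpha_\ell)$ be a strong composition. Then the key polynomial $\kappa_\alpha$ is multiplicity free (in its expansion into fundamental slide polynomials) if and only if $\alpha$ satisfies all three of the following conditions: (a) there are no indices $i<j<k$ such that $\alpha_i<\alpha_j<\alpha_k$; (b) there are no indices $i<j<k<l$ such that $\alpha_i<\alpha_l$, $\alpha_j<\alpha_l$ and $\alpha_l<\alpha_k$; (c) there are no indices $i<j<k<l$ such that $\alpha_i<\alpha_k$, $\alpha_j+1<\alpha_k$ and $\alpha_k=\alpha_l$.
   Context: A weak composition $a=(a_1,\dots,a_\ell)$ of length $\ell$ is a finite sequence of nonnegative integers; a strong composition is one whose parts are all positive. A diagram is a finite set of cells $(r,c)$ with $r,c$ positive integers, the cell $(r,c)$ lying in row $r$ (counted from the bottom) and column $c$ (counted from the left). A Kohnert tableau of content $a$ is a diagram whose cells are filled with positive integers, with exactly $a_i$ cells containing $i$ for each $i$, such that: (i) for each $i$ there is exactly one $i$ in each of the columns $1,\dots,a_i$; (ii) every entry in row $r$ is at least $r$; (iii) for each $i$, the cells containing $i$ weakly descend (their row index weakly decreases) from left to right; (iv) if $i<j$ appear in the same column with $i$ above $j$, then there is an $i$ in the column immediately to the right of the cell containing that $j$, in a row strictly above it. It is quasi-Yamanouchi if moreover (v) for each nonempty row $r$, either row $r$ contains an entry equal to $r$, or some cell of row $r+1$ lies weakly to the right of some cell of row $r$. Let $\mathrm{QKT}(a)$ be the set of quasi-Yamanouchi Kohnert tableaux of content $a$, and for a tableau $T$ let $\mathrm{wt}(T)$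 be the weak composition of length $\ell$ whose $r$-th part is the number of cells in row $r$ of $T$. For weak compositions $a,b$ of length $\ell$, $b$ dominates $a$ if $b_1+\dots+b_i\ge a_1+\dots+a_i$ for all $i$; $\mathrm{flat}(a)$ is the strong composition obtained by deleting the zeros of $a$; a strong composition $\beta$ refines a strong composition $\alpha$ if $\alpha$ is obtained by summing consecutive blocks of parts of $\beta$. The fundamental slide polynomial is $\mathfrak{F}_a=\sum x^b$ over weak compositions $b$ of length $\ell$ dominating $a$ with $\mathrm{flat}(b)$ refining $\mathrm{flat}(a)$, where $x^b=x_1^{b_1}\cdots x_\ell^{b_\ell}$. The key polynomial is $\kappa_a=\sum_T x^{\mathrm{wt}(T)}$ over all Kohnert tableaux $T$ of content $a$; it satisfies $\kappa_a=\sum_{T\in\mathrm{QKT}(a)}\mathfrak{F}_{\mathrm{wt}(T)}$. We say $\kappa_a$ is multiplicity free if distinct tableaux in $\mathrm{QKT}(a)$ have distinct weights. -}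

module Defs where

open import Data.Nat using (ℕ; zero; suc; _+_; _≤_; _<_)
open import Data.Nat.Properties using (_≟_)
open import Data.Fin as F using (Fin; toℕ)
open import Data.List using (List; length; filter; map; allFin)
open import Data.Nat.ListAction using (sum)
open import Relation.Nullary using (¬_)
open import Data.Product using (Σ; _×_; _,_)
open import Data.Sum using (_⊎_)
open import Relation.Binary.PropositionalEquality using (_≡_)

-- A weak composition of length ℓ: ℓ nonnegative parts, indexed by Fin ℓ
-- (index i : Fin ℓ stands for the paper's index toℕ i + 1).
Comp : ℕ → Set
Comp ℓ = Fin ℓ → ℕ

Strong : ∀ {ℓ} → Comp ℓ → Set
Strong {ℓ} a = ∀ (i : Fin ℓ) → 0 < a i

-- A filled diagram of content a in which, for each entry i, there is exactly
-- one cell containing i in each of the columns 1..a_i (condition (i)) and no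
-- other cell containing i.  Such a filling is determined by the row of the
-- cell containing i in column c; column c : Fin (a i) stands for the paper's
-- column toℕ c + 1, and rows are the paper's (positive) row indices.
Filling : ∀ {ℓ} → Comp ℓ → Set
Filling {ℓ} a = (i : Fin ℓ) → Fin (a i) → ℕ

entry : ∀ {ℓ} → Fin ℓ → ℕ
entry i = suc (toℕ i)

record IsKohnert {ℓ} (a : Comp ℓ) (R : Filling a) : Set where
  field
    cellsDistinct : ∀ (i j : Fin ℓ) (c : Fin (a i)) (d : Fin (a j)) →
                    toℕ c ≡ toℕ d → R i c ≡ R j d → i ≡ j
    rowPos : ∀ i c → 1 ≤ R i c
    entry≥row : ∀ i c → R i c ≤ entry i
    descend : ∀ i (c d : Fin (a i)) → toℕ c < toℕ d → R i d ≤ R i c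
    kohnert : ∀ (i j : Fin ℓ) (c : Fin (a i)) (d : Fin (a j)) →
              toℕ i < toℕ j → toℕ c ≡ toℕ d → R j d < R i c →
              Σ (Fin (a i)) λ e → (toℕ e ≡ suc (toℕ c)) × (R j d < R i e)

-- (v) quasi-Yamanouchi: for each nonempty row r (i.e. r = row of some cell),
-- row r contains the entry r, or some cell of row r+1 is weakly right of some
-- cell of row r.
QYCond : ∀ {ℓ} (a : Comp ℓ) (R : Filling a) → Set
QYCond {ℓ} a R = ∀ (i₀ : Fin ℓ) (c₀ : Fin (a i₀)) →
  (Σ (Fin ℓ) λ j → Σ (Fin (a j)) λ d → (R j d ≡ R i₀ c₀) × (entry j ≡ R i₀ c₀))
  ⊎ (Σ (Fin ℓ) λ i → Σ (Fin (a i)) λ c → Σ (Fin ℓ) λ j → Σ (Fin (a j)) λ d →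
       (R i c ≡ R i₀ c₀) × (R j d ≡ suc (R i₀ c₀)) × (toℕ c ≤ toℕ d))

record IsQKT {ℓ} (a : Comp ℓ) (R : Filling a) : Set where
  field
    kohnertTableau : IsKohnert a R
    quasiYam : QYCond a R

rowCount : ∀ {ℓ} (a : Comp ℓ) → Filling a → ℕ → ℕ
rowCount {ℓ} a R r =
  sum (map (λ i → length (filter (λ c → R i c ≟ r) (allFin (a i)))) (allFin ℓ))

wt : ∀ {ℓ} (a : Comp ℓ) → Filling a → Comp ℓ
wt a R k = rowCount a R (suc (toℕ k))

-- κ_a multiplicity free: distinct tableaux in QKT(a) have distinct weights
MultiplicityFree : ∀ {ℓ} → Comp ℓ → Set
MultiplicityFree {ℓ} a = ∀ (R R' : Filling a) → IsQKT a R → IsQKT a R' →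
  (∀ k → wt a R k ≡ wt a R' k) → ∀ i c → R i c ≡ R' i c

CondA : ∀ {ℓ} → Comp ℓ → Set
CondA {ℓ} α = ¬ (Σ (Fin ℓ) λ i → Σ (Fin ℓ) λ j → Σ (Fin ℓ) λ k →
  (toℕ i < toℕ j) × (toℕ j < toℕ k) × (α i < α j) × (α j < α k))

CondB : ∀ {ℓ} → Comp ℓ → Set
CondB {ℓ} α = ¬ (Σ (Fin ℓ) λ i → Σ (Fin ℓ) λ j → Σ (Fin ℓ) λ k → Σ (Fin ℓ) λ l →
  (toℕ i < toℕ j) × (toℕ j < toℕ k) × (toℕ k < toℕ l) ×
  (α i < α l) × (α j < α l) × (α l < α k))

CondC : ∀ {ℓ} → Comp ℓ → Set
CondC {ℓ} α = ¬ (Σ (Fin ℓ) λ i → Σ (Fin ℓ) λ j → Σ (Fin ℓ) λ k → Σ (Fin ℓ) λ l →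
  (toℕ i < toℕ j) × (toℕ j < toℕ k) × (toℕ k < toℕ l) ×
  (α i < α k) × (α j + 1 < α k) × (α k ≡ α l))

{-# OPTIONS --safe #-}
module Submission where

-- Since α is strong, the first column of a Kohnert tableau is frozen: entry i lies in row i. Hence
-- the quasi-Yamanouchi condition is automatic, and the weights of all Kohnert tableaux must be
-- distinct. Moreover the labels of a Kohnert tableau are determined by its diagram, and every
-- labelled diagram satisfying only (i)-(iii) can be relabelled so that (iv) holds. So everything
-- is about the diagrams of labellings satisfying (i)-(iii).
--
-- If a pattern (a), (b) or (c) occurs, two diagrams of equal weight arise from the diagram with
-- entry i in row i throughout by moving cells of the rows involved down:
--   (a) the last cells of j and k to the rows i and j, or that of k to the row i;
--   (b) the last cells of l and k to the rows i and j, or to the rows j and i;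
--   (c) the last cells of k and l to the rows i and j, or to the rows i and k while the
--       next-to-last cell of k moves to the row j.
-- Conversely, let two diagrams of equal weight differ, and let r be the highest row where they do.
-- There are columns c < d such that (c, r) belongs only to the first and (d, r) only to the
-- second, or vice versa. Counting cells of column c yields a part before position r that does not
-- reach column c, and the label of (d, r) is larger than r. If the r-th part does not reach column
-- c either, these parts and a label of column c form a forbidden pattern. Otherwise avoidance
-- forces all other parts up to position r to reach column d, so in the second diagram they
-- occupy every row below r in column d, contradicting the count of cells of that column.

open import Defs
open import Data.Bool using (true; false; if_then_else_)
open import Data.Empty using (⊥)
open import Data.Fin using (Fin; zero; suc; toℕ; fromℕ<; punchOut)
import Data.Fin.Properties as Fin
open import Data.Fin.Permutation.Components using (transpose; transpose-inverse)
open import Data.List using (length; filter; allFin; tabulate)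
open import Data.List.Properties using (map-tabulate)
open import Data.Nat using (ℕ; zero; suc; pred; _+_; _≤_; _<_; z≤n; s≤s; _≟_; _<?_; _≤?_)
import Data.Nat.ListAction as List
open import Data.Nat.Properties hiding (_≟_; _<?_; _≤?_)
open import Data.Nat.Tactic.RingSolver using (solve-∀)
open import Data.Product using (Σ; ∃; _×_; _,_; proj₁; proj₂)
open import Data.Sum using (_⊎_; inj₁; inj₂; [_,_]′)
open import Function using (_∘_; id)
open import Function.Bundles using (_⇔_; mk⇔)
open import Level using (0ℓ)
open import Relation.Binary.Definitions using (tri<; tri≈; tri>)
open import Relation.Binary.PropositionalEquality
open import Relation.Nullary using (¬_; Dec; does; yes; no; contradiction; ¬?)
open import Relation.Nullary.Decidable using (_×-dec_; _→-dec_; dec-true; dec-false; decidable-stable)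
open import Relation.Unary using (Pred; Decidable)
open import Algebra.Properties.CommutativeMonoid.Sum +-0-commutativeMonoid
  using (sum; sum-syntax; sum-cong-≗; sum-replicate-zero; ∑-comm)


-- Labellings satisfying (i)-(iii), and their diagrams

-- T i c is the row of the cell containing i in (0-based) column c, and 0 if there is none.
Labelling : ℕ → Set
Labelling ℓ = Fin ℓ → ℕ → ℕ

-- Conditions (i)-(iii) only. Missing cells have row 0, so `descend` holds across the end of a part
-- as well, while `distinct` has to be limited to positive rows.
record Tableau {ℓ} (a : Comp ℓ) (T : Labelling ℓ) : Set where
  field
    absent   : ∀ i {c} → a i ≤ c → T i c ≡ 0
    present  : ∀ i {c} → c < a i → 0 < T i c
    distinct : ∀ i j {c} → 0 < T i c → T i c ≡ T j c → i ≡ j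
    bounded  : ∀ i c → T i c ≤ entry i
    descend  : ∀ i c → T i (suc c) ≤ T i c

  present⁻¹ : ∀ i {c} → 0 < T i c → c < a i
  present⁻¹ i {c} 0<T = ≰⇒> λ a≤c → <-irrefl refl (subst (0 <_) (absent i a≤c) 0<T)

  descend≤ : ∀ i {c d} → c ≤ d → T i d ≤ T i c
  descend≤ i {c} {zero} z≤n = ≤-refl
  descend≤ i {c} {suc d} c≤1+d with m≤n⇒m<n∨m≡n c≤1+d
  ... | inj₁ (s≤s c≤d) = ≤-trans (descend i d) (descend≤ i c≤d)
  ... | inj₂ refl = ≤-refl

-- Condition (iv) at the cell of j in column c. As missing cells have row 0, the final inequality
-- also asserts that i has a cell in the next column.
Kohnert : ∀ {ℓ} → Labelling ℓ → ℕ → Fin ℓ → Set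
Kohnert T c j = ∀ i → toℕ i < toℕ j → T j c < T i c → T j c < T i (suc c)

IsStraight : ∀ {ℓ} → Labelling ℓ → Set
IsStraight T = ∀ c j → 0 < T j c → Kohnert T c j

Occupied : ∀ {ℓ} → Labelling ℓ → ℕ → ℕ → Set
Occupied T c r = ∃ λ i → T i c ≡ r

occupied? : ∀ {ℓ} (T : Labelling ℓ) c r → Dec (Occupied T c r)
occupied? T c r = Fin.any? λ i → T i c ≟ r

-- Containment of diagrams, with labels forgotten; `0 < r` excludes the value that marks missing
-- cells.
_⊑_ : ∀ {ℓ} → Labelling ℓ → Labelling ℓ → Set
T ⊑ T′ = ∀ c r → 0 < r → Occupied T c r → Occupied T′ c r

-- Counting cells in a column

-- Pigeonhole: the `toℕ ρ + 1` labels up to ρ do not fit into the rows 1 to `toℕ ρ`.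
injective-segment : ∀ {ℓ} (f : Fin ℓ → ℕ) (ρ : Fin ℓ) →
  (∀ e → toℕ e ≤ toℕ ρ → 0 < f e × f e ≤ toℕ ρ) →
  (∀ e e′ → toℕ e ≤ toℕ ρ → toℕ e′ ≤ toℕ ρ → f e ≡ f e′ → e ≡ e′) → ⊥
injective-segment {ℓ} f ρ range inj = Fin.<⇒notInjective ≤-refl g-injective
  where
  at : Fin (suc (toℕ ρ)) → Fin ℓ
  at e = fromℕ< (≤-<-trans (Fin.toℕ≤pred[n] e) (Fin.toℕ<n ρ))
  toℕ-at : ∀ e → toℕ (at e) ≡ toℕ e
  toℕ-at e = Fin.toℕ-fromℕ< _
  at≤ : ∀ e → toℕ (at e) ≤ toℕ ρ
  at≤ e = subst (_≤ toℕ ρ) (sym (toℕ-at e)) (Fin.toℕ≤pred[n] e)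
  pred< : ∀ {m n} → 0 < m → m ≤ n → pred m < n
  pred< (s≤s _) m≤n = m≤n
  pred-inj : ∀ {m n} → 0 < m → 0 < n → pred m ≡ pred n → m ≡ n
  pred-inj (s≤s _) (s≤s _) refl = refl
  g : Fin (suc (toℕ ρ)) → Fin (toℕ ρ)
  g e = fromℕ< (pred< (proj₁ (range (at e) (at≤ e))) (proj₂ (range (at e) (at≤ e))))
  g-injective : ∀ {e e′} → g e ≡ g e′ → e ≡ e′
  g-injective {e} {e′} eq = Fin.toℕ-injective
    (trans (sym (toℕ-at e)) (trans (cong toℕ at≡) (toℕ-at e′)))
    where
    at≡ : at e ≡ at e′
    at≡ = inj _ _ (at≤ e) (at≤ e′)
      (pred-inj (proj₁ (range _ (at≤ e))) (proj₁ (range _ (at≤ e′)))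
        (trans (sym (Fin.toℕ-fromℕ< _)) (trans (cong toℕ eq) (Fin.toℕ-fromℕ< _))))

injective⇒hits : ∀ {n} (σ : Fin n → Fin n) → (∀ {x y} → σ x ≡ σ y → x ≡ y) →
  ∀ b → ¬ (∀ e → b ≢ σ e)
injective⇒hits {suc n} σ inj b miss =
  Fin.<⇒notInjective {f = λ e → punchOut (miss e)} ≤-refl
    (λ eq → inj (Fin.punchOut-injective (miss _) (miss _) eq))

-- If all labels up to the one of row `suc u` reached column c, they would occupy distinct rows up
-- to `suc u` and avoid that row itself, contradicting the pigeonhole principle.
empty-row⇒short-part : ∀ {ℓ} {a : Comp ℓ} {T} → Tableau a T → ∀ {c u} → u < ℓ →
  ¬ Occupied T c (suc u) → ∃ λ i → toℕ i ≤ u × a i ≤ c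
empty-row⇒short-part {a = a} {T} tab {c} u<ℓ empty with fromℕ< u<ℓ | Fin.toℕ-fromℕ< u<ℓ
... | ρ | refl with Fin.any? (λ i → toℕ i ≤? toℕ ρ ×-dec a i ≤? c)
... | yes found = found
... | no none = contradiction
  (λ e e′ e≤ρ _ → distinct e e′ (proj₁ (range e e≤ρ)))
  (injective-segment (λ e → T e c) ρ range)
  where
  open Tableau tab
  range : ∀ e → toℕ e ≤ toℕ ρ → 0 < T e c × T e c ≤ toℕ ρ
  range e e≤ρ = present e (≰⇒> λ a≤c → none (e , e≤ρ , a≤c)) ,
    ≤-pred (≤∧≢⇒< (≤-trans (bounded e c) (s≤s e≤ρ)) λ eq → empty (e , eq))

-- Both columns have the same number of cells, so a cell of the first that is missing
-- in the second is compensated by one below it.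
compensate : ∀ {ℓ} {a : Comp ℓ} {T T′} → Tableau a T → Tableau a T′ → ∀ c r → 0 < r →
  (∀ r′ → r < r′ → Occupied T′ c r′ → Occupied T c r′) →
  Occupied T c r → ¬ Occupied T′ c r →
  ∃ λ u → 0 < u × u < r × ¬ Occupied T c u
compensate {ℓ} {a} {T} {T′} tab tab′ c r 0<r above (b , Tb≡r) empty
  with Fin.any? (λ e → 0 <? T′ e c ×-dec T′ e c <? r ×-dec ¬? (occupied? T c (T′ e c)))
... | yes (e , 0<u , u<r , u∉T) = T′ e c , 0<u , u<r , u∉T
... | no none = contradiction b≢σ (injective⇒hits (proj₁ ∘ σ) σ-injective b)
  where
  module S = Tableau tab
  module S′ = Tableau tab′
  occ : ∀ e → 0 < T′ e c → Occupied T c (T′ e c)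
  occ e 0<u with <-cmp (T′ e c) r
  ... | tri< u<r _ _ = decidable-stable (occupied? T c (T′ e c)) λ u∉T → none (e , 0<u , u<r , u∉T)
  ... | tri≈ _ u≡r _ = contradiction (e , u≡r) empty
  ... | tri> _ _ u>r = above _ u>r (e , refl)
  -- Without such a cell every cell of `T′` in column c would belong to `T`. Then `σ` takes the
  -- label of a cell in `T′` to its label in `T` and fixes the labels absent from the column. It is
  -- injective but misses b, the label of the cell in row r.
  σ : ∀ e → Σ (Fin ℓ) λ x → (T′ e c ≡ 0 × x ≡ e) ⊎ (0 < T′ e c × T x c ≡ T′ e c)
  σ e with 0 <? T′ e c
  ... | yes 0<u = proj₁ (occ e 0<u) , inj₂ (0<u , proj₂ (occ e 0<u))
  ... | no 0≮u = e , inj₁ (n≤0⇒n≡0 (≮⇒≥ 0≮u) , refl)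
  pos⇒pos : ∀ e → 0 < T e c → 0 < T′ e c
  pos⇒pos e = S′.present e ∘ S.present⁻¹ e
  σ-injective : ∀ {x y} → proj₁ (σ x) ≡ proj₁ (σ y) → x ≡ y
  σ-injective {x} {y} eq with σ x | σ y
  ... | _ , inj₁ (_ , refl) | _ , inj₁ (_ , refl) = eq
  ... | _ , inj₁ (x0 , refl) | _ , inj₂ (0<y , Ty) with refl ← eq =
    contradiction (sym x0) (<⇒≢ (pos⇒pos x (subst (0 <_) (sym Ty) 0<y)))
  ... | _ , inj₂ (0<x , Tx) | _ , inj₁ (y0 , refl) with refl ← eq =
    contradiction (sym y0) (<⇒≢ (pos⇒pos y (subst (0 <_) (sym Tx) 0<x)))
  ... | _ , inj₂ (0<x , Tx) | _ , inj₂ (0<y , Ty) with refl ← eq =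
    S′.distinct x y 0<x (trans (sym Tx) Ty)
  b≢σ : ∀ e → b ≢ proj₁ (σ e)
  b≢σ e eq with σ e
  ... | _ , inj₁ (e0 , refl) with refl ← eq =
    contradiction (sym e0) (<⇒≢ (pos⇒pos e (subst (0 <_) (sym Tb≡r) 0<r)))
  ... | _ , inj₂ (0<e , Te) with refl ← eq = empty (e , trans (sym Te) Tb≡r)

-- Exchanges excluded by pattern avoidance

module Avoiding {ℓ} {a : Comp ℓ} (condA : CondA a) (condB : CondB a) (condC : CondC a) where

  -- The pattern is (a), (b) or (c) according to whether `a t` is smaller than, larger than or equal
  -- to `a b`. In the case of equality both parts reach column d, and c < d supplies the gap of two
  -- that (c) demands.
  no-two-short-parts-before : ∀ {c d i ρ t b} →
    toℕ i < toℕ ρ → toℕ ρ < toℕ t → toℕ t < toℕ b →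
    a i ≤ c → a ρ ≤ c → c < d → d < a t ⊎ d < a b → c < a t → c < a b → ⊥
  no-two-short-parts-before {c} {d} {i} {ρ} {t} {b} i<ρ ρ<t t<b ai≤c aρ≤c c<d d< c<at c<ab
    with <-cmp (a t) (a b)
  ... | tri< at<ab _ _ = condA (i , t , b , <-trans i<ρ ρ<t , t<b , ≤-<-trans ai≤c c<at , at<ab)
  ... | tri> _ _ ab<at = condB (i , ρ , t , b , i<ρ , ρ<t , t<b ,
      ≤-<-trans ai≤c c<ab , ≤-<-trans aρ≤c c<ab , ab<at)
  ... | tri≈ _ at≡ab _ = condC (i , ρ , t , b , i<ρ , ρ<t , t<b ,
      ≤-<-trans ai≤c c<at , ≤-<-trans aρ+1≤d d<at , at≡ab)
    where
    d<at : d < a t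
    d<at = [ id , subst (d <_) (sym at≡ab) ]′ d<
    aρ+1≤d : a ρ + 1 ≤ d
    aρ+1≤d = ≤-trans (≤-reflexive (+-comm (a ρ) 1)) (≤-trans (s≤s aρ≤c) c<d)

  -- In T′ every entry up to the row r, except one, occupies a row below r in column c, hence
  -- also in column d, so that no row below r is empty there.
  no-exchange : ∀ {T T′} → Tableau a T → Tableau a T′ → ∀ (ρ : Fin ℓ) {c d} → c < d →
    (∀ c′ r′ → entry ρ < r′ → Occupied T c′ r′ → Occupied T′ c′ r′) →
    (∀ c′ r′ → entry ρ < r′ → Occupied T′ c′ r′ → Occupied T c′ r′) →
    Occupied T c (entry ρ) → ¬ Occupied T′ c (entry ρ) →
    Occupied T′ d (entry ρ) → ¬ Occupied T d (entry ρ) → ⊥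
  no-exchange {T} {T′} tab tab′ ρ {c} {d} c<d above above′ (b₀ , Tb₀≡r) c∉T′ (t , T′t≡r) d∉T =
    conclude (compensate tab tab′ c (entry ρ) (s≤s z≤n) (above′ c) (b₀ , Tb₀≡r) c∉T′)
    where
    module S = Tableau tab
    module S′ = Tableau tab′
    d<at : d < a t
    d<at = S′.present⁻¹ t (subst (0 <_) (sym T′t≡r) (s≤s z≤n))
    -- In `T′` the label t descends to row r in column d, so in column c it lies in row r or higher,
    -- and row r is empty there.
    r<T′tc : entry ρ < T′ t c
    r<T′tc = ≤∧≢⇒< (subst (_≤ T′ t c) T′t≡r (S′.descend≤ t (<⇒≤ c<d))) λ eq → c∉T′ (t , sym eq)
    ρ<t : toℕ ρ < toℕ t
    ρ<t = ≤-pred (≤-trans r<T′tc (S′.bounded t c))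

    -- A second long part after ρ: the label of (c, r) in `T`, or, if that is t, the label in `T` of
    -- the cell that t has in column c of `T′`; this cell lies above row r, where the diagrams
    -- agree.
    other : a ρ ≤ c → ∃ λ b → b ≢ t × toℕ ρ < toℕ b × c < a b
    other aρ≤c with b₀ Fin.≟ t
    ... | no b₀≢t = b₀ , b₀≢t , ≤∧≢⇒< ρ≤b₀ ρ≢b₀ , c<ab₀
      where
      ρ≤b₀ : toℕ ρ ≤ toℕ b₀
      ρ≤b₀ = ≤-pred (subst (_≤ entry b₀) Tb₀≡r (S.bounded b₀ c))
      c<ab₀ : c < a b₀
      c<ab₀ = S.present⁻¹ b₀ (subst (0 <_) (sym Tb₀≡r) (s≤s z≤n))
      ρ≢b₀ : toℕ ρ ≢ toℕ b₀
      ρ≢b₀ eq with refl ← Fin.toℕ-injective eq = <⇒≱ c<ab₀ aρ≤c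
    ... | yes refl with above′ c (T′ t c) r<T′tc (t , refl)
    ... | x , Tx≡ = x , (λ { refl → <⇒≢ r<T′tc (trans (sym Tb₀≡r) Tx≡) }) ,
      ≤-pred (≤-trans (subst (entry ρ <_) (sym Tx≡) r<T′tc) (S.bounded x c)) ,
      S.present⁻¹ x (subst (0 <_) (sym Tx≡) (<-trans (s≤s z≤n) r<T′tc))

    conclude : (∃ λ u → 0 < u × u < entry ρ × ¬ Occupied T c u) → ⊥
    conclude (suc u , _ , s≤s u<ρ , u∉T)
      with empty-row⇒short-part tab (<-trans u<ρ (Fin.toℕ<n ρ)) u∉T
    ... | i , i≤u , ai≤c with a ρ ≤? c
    ... | yes aρ≤c with other aρ≤c
    ... | b , b≢t , ρ<b , c<ab with <-cmp (toℕ b) (toℕ t)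
    ... | tri< b<t _ _ = no-two-short-parts-before (≤-<-trans i≤u u<ρ)
            ρ<b b<t ai≤c aρ≤c c<d (inj₂ d<at) c<ab (<-trans c<d d<at)
    ... | tri≈ _ b≡t _ = b≢t (Fin.toℕ-injective b≡t)
    ... | tri> _ _ t<b = no-two-short-parts-before (≤-<-trans i≤u u<ρ)
            ρ<t t<b ai≤c aρ≤c c<d (inj₁ d<at) (<-trans c<d d<at) c<ab
    conclude (suc u , _ , s≤s u<ρ , u∉T) | i , i≤u , ai≤c | no aρ≰c =
      -- The count is repeated in column d with the tableaux interchanged; it yields a row v below r
      -- that is empty in `T′`.
      fill (compensate tab′ tab d (entry ρ) (s≤s z≤n) (above d) (t , T′t≡r) d∉T)
      where
      i<ρ : toℕ i < toℕ ρ
      i<ρ = ≤-<-trans i≤u u<ρ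
      at≤aρ : a t ≤ a ρ
      at≤aρ = ≮⇒≥ λ aρ<at → condA (i , ρ , t , i<ρ , ρ<t , ≤-<-trans ai≤c (≰⇒> aρ≰c) , aρ<at)
      d<aρ : d < a ρ
      d<aρ = ≤-trans d<at at≤aρ
      ai<d : a i < d
      ai<d = ≤-<-trans ai≤c c<d
      +1< : ∀ {m} → m < d → m + 1 < a ρ
      +1< {m} m<d = ≤-<-trans (≤-trans (≤-reflexive (+-comm m 1)) m<d) d<aρ
      only-i : ∀ e → toℕ e ≤ toℕ ρ → e ≢ i → d < a e
      only-i e e≤ρ e≢i = ≰⇒> absurd
        where
        absurd : ¬ (a e ≤ d)
        absurd ae≤d with m≤n⇒m<n∨m≡n e≤ρ
        ... | inj₂ e≡ρ = <⇒≱ d<aρ (subst (λ x → a x ≤ d) (Fin.toℕ-injective e≡ρ) ae≤d)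
        ... | inj₁ e<ρ with <-cmp (toℕ e) (toℕ i) | m≤n⇒m<n∨m≡n at≤aρ
        ... | tri≈ _ e≡i _ | _ = e≢i (Fin.toℕ-injective e≡i)
        ... | tri< e<i _ _ | inj₁ at<aρ = condB (e , i , ρ , t , e<i , i<ρ , ρ<t ,
                ≤-<-trans ae≤d d<at , <-trans ai<d d<at , at<aρ)
        ... | tri< e<i _ _ | inj₂ at≡aρ = condC (e , i , ρ , t , e<i , i<ρ , ρ<t ,
                ≤-<-trans ae≤d d<aρ , +1< ai<d , sym at≡aρ)
        ... | tri> _ _ i<e | inj₁ at<aρ = condB (i , e , ρ , t , i<e , e<ρ , ρ<t ,
                <-trans ai<d d<at , ≤-<-trans ae≤d d<at , at<aρ)
        ... | tri> _ _ i<e | inj₂ at≡aρ with a i <? a e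
        ... | yes ai<ae = condA (i , e , ρ , i<e , e<ρ , ai<ae , ≤-<-trans ae≤d d<aρ)
        ... | no ai≮ae = condC (i , e , ρ , t , i<e , e<ρ , ρ<t ,
                <-trans ai<d d<aρ , +1< (≤-<-trans (≮⇒≥ ai≮ae) ai<d) , sym at≡aρ)
      fill : (∃ λ v → 0 < v × v < entry ρ × ¬ Occupied T′ d v) → ⊥
      fill (v , 0<v , s≤s v≤ρ , v∉T′) = injective-segment h ρ range inj
        where
        -- Sending i to the empty row v and every other label to its row in column d would place all
        -- labels up to ρ in distinct rows below r.
        h : Fin ℓ → ℕ
        h e with e Fin.≟ i
        ... | yes _ = v
        ... | no _ = T′ e d
        range : ∀ e → toℕ e ≤ toℕ ρ → 0 < h e × h e ≤ toℕ ρ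
        range e e≤ρ with e Fin.≟ i
        ... | yes _ = 0<v , v≤ρ
        ... | no e≢i = S′.present e (only-i e e≤ρ e≢i) ,
          -- In column c the label e lies below row r, since it is bounded by r and that row is
          -- empty; descending keeps it below in column d.
          ≤-pred (≤-<-trans (S′.descend≤ e (<⇒≤ c<d))
            (≤∧≢⇒< (≤-trans (S′.bounded e c) (s≤s e≤ρ)) λ eq → c∉T′ (e , eq)))
        inj : ∀ e e′ → toℕ e ≤ toℕ ρ → toℕ e′ ≤ toℕ ρ → h e ≡ h e′ → e ≡ e′
        inj e e′ e≤ρ e′≤ρ eq with e Fin.≟ i | e′ Fin.≟ i
        ... | yes refl | yes refl = refl
        ... | yes _ | no _ = contradiction (e′ , sym eq) v∉T′
        ... | no _ | yes _ = contradiction (e , eq) v∉T′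
        ... | no e≢i | no _ = S′.distinct e e′ (S′.present e (only-i e e≤ρ e≢i)) eq

-- Row totals as sums of indicators

-- Written with `does` so that it agrees definitionally with the summands of
-- `length-filter-tabulate`.
δ : ℕ → ℕ → ℕ
δ m n = if does (m ≟ n) then 1 else 0

δ-≡ : ∀ {m n} → m ≡ n → δ m n ≡ 1
δ-≡ {m} {n} eq = cong (if_then 1 else 0) (dec-true (m ≟ n) eq)

δ-≢ : ∀ {m n} → m ≢ n → δ m n ≡ 0
δ-≢ {m} {n} neq = cong (if_then 1 else 0) (dec-false (m ≟ n) neq)

sum-tabulate : ∀ {n} (f : Fin n → ℕ) → List.sum (tabulate f) ≡ sum f
sum-tabulate {zero} f = refl
sum-tabulate {suc n} f = cong (f zero +_) (sum-tabulate (f ∘ suc))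

length-filter-tabulate : ∀ {n} {A : Set} {P : Pred A 0ℓ} (P? : Decidable P) (f : Fin n → A) →
  length (filter P? (tabulate f)) ≡ sum (λ i → if does (P? (f i)) then 1 else 0)
length-filter-tabulate {zero} P? f = refl
length-filter-tabulate {suc n} P? f with does (P? (f zero))
... | true = cong suc (length-filter-tabulate P? (f ∘ suc))
... | false = length-filter-tabulate P? (f ∘ suc)

sum-zero : ∀ {n} (f : Fin n → ℕ) → (∀ i → f i ≡ 0) → sum f ≡ 0
sum-zero {n} f f≡0 = trans (sum-cong-≗ f≡0) (sum-replicate-zero n)

sum-truncate : ∀ {m n} (f : ℕ → ℕ) → m ≤ n → (∀ c → m ≤ c → f c ≡ 0) →
  ∑[ c < n ] f (toℕ c) ≡ ∑[ c < m ] f (toℕ c)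
sum-truncate {n = n} f z≤n f≡0 = sum-zero {n} _ λ c → f≡0 (toℕ c) z≤n
sum-truncate f (s≤s m≤n) f≡0 = cong (f 0 +_) (sum-truncate (f ∘ suc) m≤n λ c → f≡0 (suc c) ∘ s≤s)

≤-sum : ∀ {n} (f : Fin n → ℕ) i → f i ≤ sum f
≤-sum f zero = m≤m+n _ _
≤-sum f (suc i) = ≤-trans (≤-sum (f ∘ suc) i) (m≤n+m _ _)

sum-transfer : ∀ {n} (f g : Fin n → ℕ) → sum f ≤ sum g → ∀ i → g i < f i → ∃ λ j → f j < g j
sum-transfer {n} f g f≤g i g<f with Fin.any? (λ j → f j <? g j)
... | yes found = found
... | no none = contradiction f≤g (<⇒≱ (sum-< f g (λ j → ≮⇒≥ λ p → none (j , p)) i g<f))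
  where
  sum-≤ : ∀ {n} (f g : Fin n → ℕ) → (∀ j → g j ≤ f j) → sum g ≤ sum f
  sum-≤ {zero} f g g≤f = z≤n
  sum-≤ {suc n} f g g≤f = +-mono-≤ (g≤f zero) (sum-≤ (f ∘ suc) (g ∘ suc) (g≤f ∘ suc))
  sum-< : ∀ {n} (f g : Fin n → ℕ) → (∀ j → g j ≤ f j) → ∀ i → g i < f i → sum g < sum f
  sum-< f g g≤f zero g<f = +-mono-<-≤ g<f (sum-≤ (f ∘ suc) (g ∘ suc) (g≤f ∘ suc))
  sum-< f g g≤f (suc i) g<f = +-mono-≤-< (g≤f zero) (sum-< (f ∘ suc) (g ∘ suc) (g≤f ∘ suc) i g<f)

sum-indicator : ∀ {n} (f : Fin n → ℕ) r → (∀ i j → f i ≡ r → f j ≡ r → i ≡ j) →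
  ∑[ i < n ] δ (f i) r ≡ (if does (Fin.any? (λ i → f i ≟ r)) then 1 else 0)
sum-indicator f r unique with Fin.any? (λ i → f i ≟ r)
... | no none = sum-zero _ λ i → δ-≢ λ eq → none (i , eq)
... | yes (i , fi≡r) = single f i fi≡r λ j fj≡r → unique j i fj≡r fi≡r
  where
  single : ∀ {n} (f : Fin n → ℕ) i → f i ≡ r → (∀ j → f j ≡ r → j ≡ i) → ∑[ i < n ] δ (f i) r ≡ 1
  single f zero eq only = cong₂ _+_ (δ-≡ eq) (sum-zero _ λ j → δ-≢ λ eq′ → Fin.0≢1+n (sym (only (suc j) eq′)))
  single f (suc i) eq only = cong₂ _+_ (δ-≢ λ eq′ → Fin.0≢1+n (only zero eq′))
    (single (f ∘ suc) i eq λ j eq′ → Fin.suc-injective (only (suc j) eq′))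

-- A common bound N on the columns allows the two sums to be exchanged; the columns beyond a part
-- count only towards row 0.
rowTotal : ∀ {ℓ} → ℕ → Labelling ℓ → ℕ → ℕ
rowTotal {ℓ} N T r = ∑[ i < ℓ ] ∑[ c < N ] δ (T i (toℕ c)) r

occupancy : ∀ {ℓ} → Labelling ℓ → ℕ → ℕ → ℕ
occupancy T c r = if does (occupied? T c r) then 1 else 0

occupancy-yes : ∀ {ℓ} (T : Labelling ℓ) c r → Occupied T c r → occupancy T c r ≡ 1
occupancy-yes T c r occ = cong (if_then 1 else 0) (dec-true (occupied? T c r) occ)

occupancy-no : ∀ {ℓ} (T : Labelling ℓ) c r → ¬ Occupied T c r → occupancy T c r ≡ 0
occupancy-no T c r unocc = cong (if_then 1 else 0) (dec-false (occupied? T c r) unocc)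

-- Once the sums are exchanged, each column holds at most one label in row r. Hence row totals
-- depend on the diagram alone.
rowTotal-occupancy : ∀ {ℓ} {a : Comp ℓ} {T} → Tableau a T → ∀ N r → 0 < r →
  rowTotal N T r ≡ ∑[ c < N ] occupancy T (toℕ c) r
rowTotal-occupancy {ℓ} {T = T} tab N r 0<r = trans (∑-comm {ℓ} {N} (λ i c → δ (T i (toℕ c)) r))
  (sum-cong-≗ {N} λ c → sum-indicator (λ i → T i (toℕ c)) r
    λ i j i≡r j≡r → Tableau.distinct tab i j (subst (0 <_) (sym i≡r) 0<r) (trans i≡r (sym j≡r)))

occupancy-cong : ∀ {ℓ} {T T′ : Labelling ℓ} → T ⊑ T′ → T′ ⊑ T → ∀ c r → 0 < r →
  occupancy T c r ≡ occupancy T′ c r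
occupancy-cong {T = T} {T′} T⊑T′ T′⊑T c r 0<r with occupied? T c r
... | yes occ = sym (occupancy-yes T′ c r (T⊑T′ c r 0<r occ))
... | no unocc = sym (occupancy-no T′ c r (unocc ∘ T′⊑T c r 0<r))

rowTotal-cong : ∀ {ℓ} {a : Comp ℓ} {T T′} → Tableau a T → Tableau a T′ → T ⊑ T′ → T′ ⊑ T →
  ∀ N r → 0 < r → rowTotal N T r ≡ rowTotal N T′ r
rowTotal-cong tab tab′ T⊑T′ T′⊑T N r 0<r =
  trans (rowTotal-occupancy tab N r 0<r)
    (trans (sum-cong-≗ {N} λ c → occupancy-cong T⊑T′ T′⊑T (toℕ c) r 0<r)
      (sym (rowTotal-occupancy tab′ N r 0<r)))

rowCount≡rowTotal : ∀ {ℓ} {a : Comp ℓ} {T} → Tableau a T → (R : Filling a) →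
  (∀ i c → T i (toℕ c) ≡ R i c) → ∀ r → 0 < r → rowCount a R r ≡ rowTotal (sum a) T r
rowCount≡rowTotal {ℓ} {a} {T} tab R T≡R r 0<r =
  trans (cong List.sum (map-tabulate id rowPart)) (trans (sum-tabulate rowPart)
    (sum-cong-≗ {ℓ} λ i → trans (length-filter-tabulate (λ c → R i c ≟ r) id)
      (trans (sum-cong-≗ {a i} λ c → cong (λ x → δ x r) (sym (T≡R i c)))
        (sym (sum-truncate (λ c → δ (T i c) r) (≤-sum a i) λ c a≤c →
          δ-≢ λ eq → <⇒≢ 0<r (trans (sym (Tableau.absent tab i a≤c)) eq))))))
  where
  rowPart : Fin ℓ → ℕ
  rowPart i = length (filter (λ c → R i c ≟ r) (allFin (a i)))

-- Under avoidance, the weight determines the diagram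

module WeightDeterminesDiagram {ℓ} {a : Comp ℓ} (condA : CondA a) (condB : CondB a) (condC : CondC a) where
  open Avoiding condA condB condC

  private
    N = sum a

  -- Downward induction on the row r, with n bounding the number of rows still above; the diagrams
  -- agree there by induction, in both directions.
  same-diagram : ∀ n {T T′} → Tableau a T → Tableau a T′ →
    (∀ k → rowTotal N T (entry {ℓ} k) ≡ rowTotal N T′ (entry k)) →
    ∀ r → 0 < r → ℓ < n + r → ∀ c → Occupied T c r → Occupied T′ c r
  same-diagram zero tab tab′ wt≡ r 0<r ℓ<r c (i , Ti≡r) =
    contradiction (≤-trans (≤-trans ℓ<r (≤-reflexive (sym Ti≡r)))
      (≤-trans (Tableau.bounded tab i c) (Fin.toℕ<n i))) (<-irrefl refl)
  same-diagram (suc n) {T} {T′} tab tab′ wt≡ (suc r) 0<r ℓ<n+r c occ with occupied? T′ c (suc r)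
  ... | yes occ′ = occ′
  ... | no unocc = contradiction occ (absurd (r <? ℓ))
    where
    above : ∀ {T T′} → Tableau a T → Tableau a T′ →
      (∀ k → rowTotal N T (entry {ℓ} k) ≡ rowTotal N T′ (entry k)) →
      ∀ c r′ → suc r < r′ → Occupied T c r′ → Occupied T′ c r′
    above tab tab′ wt≡ c r′ r<r′ = same-diagram n tab tab′ wt≡ r′ (<-trans (s≤s z≤n) r<r′)
      (≤-trans ℓ<n+r (≤-trans (≤-reflexive (sym (+-suc n (suc r)))) (+-monoʳ-≤ n r<r′))) c
    absurd : Dec (r < ℓ) → ¬ Occupied T c (suc r)
    absurd (no r≮ℓ) (i , Ti≡r) = r≮ℓ (≤-trans (≤-reflexive (sym Ti≡r))
      (≤-trans (Tableau.bounded tab i c) (Fin.toℕ<n i)))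
    absurd (yes r<ℓ) occ with fromℕ< r<ℓ | Fin.toℕ-fromℕ< r<ℓ
    -- Row totals being equal, the surplus of `T` at column c forces a surplus of `T′` at some
    -- column d.
    ... | ρ | refl = exchange (sum-transfer (λ c → occupancy T (toℕ c) (entry ρ))
        (λ c → occupancy T′ (toℕ c) (entry ρ)) (≤-reflexive occ≡) (fromℕ< c<N)
        (subst (λ x → occupancy T′ x (entry ρ) < occupancy T x (entry ρ)) (sym (Fin.toℕ-fromℕ< c<N))
          (≤-reflexive (trans (cong suc (occupancy-no T′ c _ unocc)) (sym (occupancy-yes T c _ occ))))))
      where
      occ≡ : ∑[ c < N ] occupancy T (toℕ c) (entry ρ) ≡ ∑[ c < N ] occupancy T′ (toℕ c) (entry ρ)
      occ≡ = trans (sym (rowTotal-occupancy tab N _ (s≤s z≤n)))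
        (trans (wt≡ ρ) (rowTotal-occupancy tab′ N _ (s≤s z≤n)))
      c<N : c < N
      c<N = ≤-trans (Tableau.present⁻¹ tab (proj₁ occ) (subst (0 <_) (sym (proj₂ occ)) (s≤s z≤n)))
        (≤-sum a (proj₁ occ))
      exchange : (∃ λ d → occupancy T (toℕ d) (entry ρ) < occupancy T′ (toℕ d) (entry ρ)) → ⊥
      exchange (d , lt) with occupied? T (toℕ d) (entry ρ) | occupied? T′ (toℕ d) (entry ρ)
      exchange (d , ()) | yes _ | no _
      exchange (d , s≤s ()) | yes _ | yes _
      exchange (d , ()) | no _ | no _
      -- The tableau with the extra cell further left plays the first role in `no-exchange`.
      ... | no d∉T | yes d∈T′ with <-cmp c (toℕ d)
      ... | tri< c<d _ _ = no-exchange tab tab′ ρ c<d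
            (above tab tab′ wt≡) (above tab′ tab (sym ∘ wt≡)) occ unocc d∈T′ d∉T
      ... | tri≈ _ c≡d _ = d∉T (subst (λ x → Occupied T x (entry ρ)) c≡d occ)
      ... | tri> _ _ d<c = no-exchange tab′ tab ρ d<c
            (above tab′ tab (sym ∘ wt≡)) (above tab tab′ wt≡) d∈T′ d∉T occ unocc

-- The diagram determines the labels

-- In a straight tableau each cell carries the smallest label among those not yet used below it
-- in its column that the next column allows; hence the labels are recovered from the diagram
-- column by column from right to left, each column from bottom to top.
module _ {ℓ} {a : Comp ℓ} where

  same-column : ∀ c s n {T T′} → Tableau a T → Tableau a T′ → IsStraight T → IsStraight T′ →
    T ⊑ T′ → T′ ⊑ T → (∀ i → T i (suc c) ≡ T′ i (suc c)) →
    s < n → 0 < s → ∀ i → T i c ≡ s → T′ i c ≡ s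
  same-column c s (suc n) {T} {T′} tab tab′ straight straight′ T⊑T′ T′⊑T next (s≤s s≤n) 0<s i Ti≡s
    with T⊑T′ c s 0<s (i , Ti≡s)
  ... | i′ , T′i′≡s with <-cmp (toℕ i) (toℕ i′)
  ... | tri≈ _ i≡i′ _ rewrite Fin.toℕ-injective i≡i′ = T′i′≡s
  -- If `T′` had i below row s, induction would give `T` the same cell. If it had i above,
  -- straightness at i′ would put i above s in the next column too, where it agrees with `T` and `T`
  -- has descended to s or lower.
  ... | tri< i<i′ _ _ with <-cmp (T′ i c) s
  ... | tri≈ _ eq _ = eq
  ... | tri< lt _ _ = contradiction
        (same-column c _ n tab′ tab straight′ straight T′⊑T T⊑T′ (sym ∘ next) (≤-trans lt s≤n)
          (Tableau.present tab′ i (Tableau.present⁻¹ tab i (subst (0 <_) (sym Ti≡s) 0<s))) i refl)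
        (λ eq → <⇒≢ lt (trans (sym eq) Ti≡s))
  ... | tri> _ _ gt = contradiction
        (straight′ c i′ (subst (0 <_) (sym T′i′≡s) 0<s) i i<i′ (subst (_< T′ i c) (sym T′i′≡s) gt))
        (≤⇒≯ (≤-trans (≤-reflexive (sym (next i))) (≤-trans (Tableau.descend tab i c)
          (≤-reflexive (trans Ti≡s (sym T′i′≡s))))))
  same-column c s (suc n) {T} {T′} tab tab′ straight straight′ T⊑T′ T′⊑T next (s≤s s≤n) 0<s i Ti≡s
    | i′ , T′i′≡s | tri> _ _ i′<i with <-cmp (T i′ c) s
  ... | tri≈ _ eq _ = contradiction
        (cong toℕ (Tableau.distinct tab i′ i (subst (0 <_) (sym eq) 0<s) (trans eq (sym Ti≡s)))) (<⇒≢ i′<i)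
  ... | tri< lt _ _ = contradiction
        (same-column c _ n tab tab′ straight straight′ T⊑T′ T′⊑T next (≤-trans lt s≤n)
          (Tableau.present tab i′ (Tableau.present⁻¹ tab′ i′ (subst (0 <_) (sym T′i′≡s) 0<s))) i′ refl)
        (λ eq → <⇒≢ lt (trans (sym eq) T′i′≡s))
  ... | tri> _ _ gt = contradiction
        (straight c i (subst (0 <_) (sym Ti≡s) 0<s) i′ i′<i (subst (_< T i′ c) (sym Ti≡s) gt))
        (≤⇒≯ (≤-trans (≤-reflexive (next i′)) (≤-trans (Tableau.descend tab′ i′ c)
          (≤-reflexive (trans T′i′≡s (sym Ti≡s))))))

  diagram-determines-labels : ∀ {T T′} → Tableau a T → Tableau a T′ → IsStraight T → IsStraight T′ →
    T ⊑ T′ → T′ ⊑ T → ∀ n c → sum a ≤ n + c → ∀ i → T i c ≡ T′ i c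
  diagram-determines-labels tab tab′ _ _ _ _ zero c N≤c i =
    trans (Tableau.absent tab i a≤c) (sym (Tableau.absent tab′ i a≤c))
    where
    a≤c = ≤-trans (≤-sum a i) N≤c
  diagram-determines-labels {T} tab tab′ straight straight′ T⊑T′ T′⊑T (suc n) c N≤n+c i with c <? a i
  ... | no c≮a = trans (Tableau.absent tab i (≮⇒≥ c≮a)) (sym (Tableau.absent tab′ i (≮⇒≥ c≮a)))
  ... | yes c<a = sym (same-column c _ _ tab tab′ straight straight′ T⊑T′ T′⊑T
        (diagram-determines-labels tab tab′ straight straight′ T⊑T′ T′⊑T n (suc c)
          (≤-trans N≤n+c (≤-reflexive (sym (+-suc n c)))))
        ≤-refl (Tableau.present tab i c<a) i refl)

-- From fillings to labellings

module _ {ℓ} {a : Comp ℓ} where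

  labelling : Filling a → Labelling ℓ
  labelling R i c with c <? a i
  ... | yes c<a = R i (fromℕ< c<a)
  ... | no _ = 0

  labelling-toℕ : ∀ (R : Filling a) i c → labelling R i (toℕ c) ≡ R i c
  labelling-toℕ R i c with toℕ c <? a i
  ... | yes c<a = cong (R i) (Fin.fromℕ<-toℕ c c<a)
  ... | no c≮a = contradiction (Fin.toℕ<n c) c≮a

  labelling-fromℕ< : ∀ (R : Filling a) i {c} (c<a : c < a i) → labelling R i c ≡ R i (fromℕ< c<a)
  labelling-fromℕ< R i {c} c<a = subst (λ x → labelling R i x ≡ R i (fromℕ< c<a)) (Fin.toℕ-fromℕ< c<a)
    (labelling-toℕ R i (fromℕ< c<a))

  labelling-absent : ∀ (R : Filling a) i {c} → a i ≤ c → labelling R i c ≡ 0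
  labelling-absent R i {c} a≤c with c <? a i
  ... | yes c<a = contradiction a≤c (<⇒≱ c<a)
  ... | no _ = refl

  labelling-column : ∀ (R : Filling a) i {c} → 0 < labelling R i c →
    ∃ λ d → toℕ d ≡ c × labelling R i c ≡ R i d
  labelling-column R i {c} 0<R with c <? a i
  ... | yes c<a = fromℕ< c<a , Fin.toℕ-fromℕ< c<a , refl

  labelling-tableau : ∀ {R : Filling a} → IsKohnert a R → Tableau a (labelling R)
  labelling-tableau {R} K = record
    { absent = labelling-absent R
    ; present = λ i c<a → subst (0 <_) (sym (labelling-fromℕ< R i c<a)) (K.rowPos i _)
    ; distinct = distinct
    ; bounded = bounded
    ; descend = descend
    }
    where
    module K = IsKohnert K
    distinct : ∀ i j {c} → 0 < labelling R i c → labelling R i c ≡ labelling R j c → i ≡ j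
    distinct i j 0<i i≡j with labelling-column R i 0<i | labelling-column R j (subst (0 <_) i≡j 0<i)
    ... | d , refl , Rd | e , e≡d , Re = K.cellsDistinct i j d e (sym e≡d) (trans (sym Rd) (trans i≡j Re))
    bounded : ∀ i c → labelling R i c ≤ entry i
    bounded i c with c <? a i
    ... | yes _ = K.entry≥row i _
    ... | no _ = z≤n
    descend : ∀ i c → labelling R i (suc c) ≤ labelling R i c
    descend i c with suc c <? a i
    ... | no _ = z≤n
    ... | yes 1+c<a = subst (R i (fromℕ< 1+c<a) ≤_) (sym (labelling-fromℕ< R i c<a))
      (K.descend i _ _ (≤-reflexive (trans (cong suc (Fin.toℕ-fromℕ< c<a)) (sym (Fin.toℕ-fromℕ< 1+c<a)))))
      where
      c<a : c < a i
      c<a = <-trans (n<1+n c) 1+c<a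

  labelling-straight : ∀ {R : Filling a} → IsKohnert a R → IsStraight (labelling R)
  labelling-straight {R} K c j 0<j i i<j j<i
    with labelling-column R j 0<j | labelling-column R i (<-trans 0<j j<i)
  ... | d , refl , Rd | e , e≡d , Re
    with IsKohnert.kohnert K i j e d i<j e≡d (subst₂ _<_ Rd Re j<i)
  ... | f , f≡1+e , lt = subst₂ _<_ (sym Rd)
    (trans (sym (labelling-toℕ R i f)) (cong (labelling R i) (trans f≡1+e (cong suc e≡d)))) lt

-- Avoidance implies multiplicity freeness

avoiding⇒multiplicityFree : ∀ {ℓ} {a : Comp ℓ} → CondA a × CondB a × CondC a → MultiplicityFree a
avoiding⇒multiplicityFree {ℓ} {a} (condA , condB , condC) R R′ Q Q′ wt≡ i c =
  trans (sym (labelling-toℕ R i c)) (trans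
    (diagram-determines-labels tab tab′ (labelling-straight K) (labelling-straight K′)
      (λ c r 0<r → same-diagram (suc ℓ) tab tab′ total≡ r 0<r (s≤s (m≤m+n ℓ r)) c)
      (λ c r 0<r → same-diagram (suc ℓ) tab′ tab (sym ∘ total≡) r 0<r (s≤s (m≤m+n ℓ r)) c)
      (sum a) (toℕ c) (m≤m+n _ _) i)
    (labelling-toℕ R′ i c))
  where
  open WeightDeterminesDiagram condA condB condC
  K = IsQKT.kohnertTableau Q
  K′ = IsQKT.kohnertTableau Q′
  tab = labelling-tableau K
  tab′ = labelling-tableau K′
  total≡ : ∀ k → rowTotal (sum a) (labelling R) (entry {ℓ} k) ≡ rowTotal (sum a) (labelling R′) (entry k)
  total≡ k = trans (sym (rowCount≡rowTotal tab R (labelling-toℕ R) _ (s≤s z≤n)))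
    (trans (wt≡ k) (rowCount≡rowTotal tab′ R′ (labelling-toℕ R′) _ (s≤s z≤n)))

-- Straightening: relabelling a diagram to satisfy (iv)

transpose-cases : ∀ {n} (i j g : Fin n) → (g ≡ i × transpose i j g ≡ j) ⊎ (g ≡ j × transpose i j g ≡ i)
  ⊎ (g ≢ i × g ≢ j × transpose i j g ≡ g)
transpose-cases i j g with g Fin.≟ i
... | yes g≡i = inj₁ (g≡i , refl)
... | no g≢i with g Fin.≟ j
... | yes g≡j = inj₂ (inj₁ (g≡j , refl))
... | no g≢j = inj₂ (inj₂ (g≢i , g≢j , refl))

-- Removing a violation of the Kohnert condition: the labels i and j trade places in column c,
-- and in the columns to its left as long as i and j would otherwise fail to descend.
module Swap {ℓ} {a : Comp ℓ} {T : Labelling ℓ} (tab : Tableau a T) (c : ℕ) (i j : Fin ℓ)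
  (i<j : toℕ i < toℕ j) (0<j : 0 < T j c) (j<i : T j c < T i c) (fits : T i (suc c) ≤ T j c) where
  open Tableau tab

  -- The swap reaches column x if, at each column y from x up to c, exclusive, j would otherwise lie
  -- below the cell it receives from i in column `suc y`.
  Carried : ℕ → Set
  Carried x = x ≤ c × (∀ {y} → y < c → x ≤ y → T j y < T i (suc y))

  carried? : ∀ x → Dec (Carried x)
  carried? x = x ≤? c ×-dec allUpTo? (λ y → x ≤? y →-dec T j y <? T i (suc y)) c

  swapped : Labelling ℓ
  swapped g x with carried? x
  ... | yes _ = T (transpose i j g) x
  ... | no _ = T g x

  carried-c : Carried c
  carried-c = ≤-refl , λ {_} y<c c≤y → contradiction c≤y (<⇒≱ y<c)

  -- Hence the swap moves i down and j up to a row at most `entry i`, which preserves `bounded`.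
  inverted : ∀ {x} → Carried x → T j x < T i x
  inverted {x} (x≤c , chain) with m≤n⇒m<n∨m≡n x≤c
  ... | inj₁ x<c = ≤-trans (chain x<c ≤-refl) (descend i x)
  ... | inj₂ refl = j<i

  column<i : ∀ {x} → x ≤ c → x < a i
  column<i x≤c = ≤-<-trans x≤c (present⁻¹ i (<-trans 0<j j<i))

  column<j : ∀ {x} → x ≤ c → x < a j
  column<j x≤c = ≤-<-trans x≤c (present⁻¹ j 0<j)

  swapped-c : ∀ g → swapped g c ≡ T (transpose i j g) c
  swapped-c g with carried? c
  ... | yes _ = refl
  ... | no ¬carried = contradiction carried-c ¬carried

  swapped-right : ∀ g {x} → c < x → swapped g x ≡ T g x
  swapped-right g {x} c<x with carried? x
  ... | yes (x≤c , _) = contradiction x≤c (<⇒≱ c<x)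
  ... | no _ = refl

  swapped-tableau : Tableau a swapped
  swapped-tableau = record
    { absent = absent′
    ; present = present′
    ; distinct = distinct′
    ; bounded = bounded′
    ; descend = descend′
    }
    where
    absent′ : ∀ g {x} → a g ≤ x → swapped g x ≡ 0
    absent′ g {x} a≤x with carried? x
    ... | no _ = absent g a≤x
    ... | yes (x≤c , _) with transpose-cases i j g
    ... | inj₁ (refl , _) = contradiction a≤x (<⇒≱ (column<i x≤c))
    ... | inj₂ (inj₁ (refl , _)) = contradiction a≤x (<⇒≱ (column<j x≤c))
    ... | inj₂ (inj₂ (_ , _ , eq)) rewrite eq = absent g a≤x
    present′ : ∀ g {x} → x < a g → 0 < swapped g x
    present′ g {x} x<a with carried? x
    ... | no _ = present g x<a
    ... | yes (x≤c , _) with transpose-cases i j g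
    ... | inj₁ (_ , eq) rewrite eq = present j (column<j x≤c)
    ... | inj₂ (inj₁ (_ , eq)) rewrite eq = present i (column<i x≤c)
    ... | inj₂ (inj₂ (_ , _ , eq)) rewrite eq = present g x<a
    distinct′ : ∀ g h {x} → 0 < swapped g x → swapped g x ≡ swapped h x → g ≡ h
    distinct′ g h {x} 0<g g≡h with carried? x
    ... | no _ = distinct g h 0<g g≡h
    ... | yes _ = trans (sym (transpose-inverse j i))
      (trans (cong (transpose j i) (distinct _ _ 0<g g≡h)) (transpose-inverse j i))
    bounded′ : ∀ g x → swapped g x ≤ entry g
    bounded′ g x with carried? x
    ... | no _ = bounded g x
    ... | yes carried with transpose-cases i j g
    ... | inj₁ (refl , eq) rewrite eq = ≤-trans (<⇒≤ (inverted carried)) (bounded i x)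
    ... | inj₂ (inj₁ (refl , eq)) rewrite eq = ≤-trans (bounded i x) (s≤s (<⇒≤ i<j))
    ... | inj₂ (inj₂ (_ , _ , eq)) rewrite eq = bounded g x
    descend′ : ∀ g x → swapped g (suc x) ≤ swapped g x
    descend′ g x with carried? x | carried? (suc x)
    ... | no _ | no _ = descend g x
    ... | yes _ | yes _ = descend (transpose i j g) x
    ... | yes carried@(x≤c , chain) | no ¬carried with m≤n⇒m<n∨m≡n x≤c
    ... | inj₁ x<c = contradiction (x<c , λ {_} y<c x<y → chain y<c (<⇒≤ x<y)) ¬carried
    ... | inj₂ refl with transpose-cases i j g
    ... | inj₁ (refl , eq) rewrite eq = fits
    ... | inj₂ (inj₁ (refl , eq)) rewrite eq = ≤-trans (descend j x) (<⇒≤ j<i)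
    ... | inj₂ (inj₂ (_ , _ , eq)) rewrite eq = descend g x
    descend′ g x | no ¬carried | yes carried@(x<c , chain) with transpose-cases i j g
    ... | inj₁ (refl , eq) rewrite eq = ≤-trans (<⇒≤ (inverted carried)) (descend i x)
    ... | inj₂ (inj₂ (_ , _ , eq)) rewrite eq = descend g x
    -- Left end of the swap: if j failed to descend here, column x would have been carried as well.
    ... | inj₂ (inj₁ (refl , eq)) rewrite eq = ≮⇒≥ λ lt →
      ¬carried (<⇒≤ x<c , λ {_} y<c x≤y → extend lt y<c (m≤n⇒m<n∨m≡n x≤y))
      where
      extend : ∀ {y} → T j x < T i (suc x) → y < c → x < y ⊎ x ≡ y → T j y < T i (suc y)
      extend lt y<c (inj₁ x<y) = chain y<c x<y
      extend lt y<c (inj₂ refl) = lt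

  swapped-⊒ : T ⊑ swapped
  swapped-⊒ x r _ (g , Tg≡r) with carried? x
  ... | no _ = g , Tg≡r
  ... | yes _ = transpose j i g , trans (cong (λ h → T h x) (transpose-inverse i j)) Tg≡r

  swapped-⊑ : swapped ⊑ T
  swapped-⊑ x r _ (g , Tg≡r) with carried? x
  ... | no _ = g , Tg≡r
  ... | yes _ = transpose i j g , Tg≡r

module Straightening {ℓ} {a : Comp ℓ} where

  Relabelled : Labelling ℓ → (Labelling ℓ → Set) → Set
  Relabelled T P = ∃ λ T′ → Tableau a T′ × T ⊑ T′ × T′ ⊑ T × P T′

  relabelled-trans : ∀ {T T′ P} → T ⊑ T′ → T′ ⊑ T → Relabelled T′ P → Relabelled T P
  relabelled-trans T⊑T′ T′⊑T (T″ , tab , T′⊑T″ , T″⊑T′ , P) = T″ , tab ,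
    (λ c r 0<r → T′⊑T″ c r 0<r ∘ T⊑T′ c r 0<r) , (λ c r 0<r → T′⊑T c r 0<r ∘ T″⊑T′ c r 0<r) , P

  StraightFrom : ℕ → Labelling ℓ → Set
  StraightFrom c T = ∀ x j → c ≤ x → 0 < T j x → Kohnert T x j

  -- Measures the progress: columns from right to left, and rows of column c from bottom to top.
  StraightBelow : ℕ → ℕ → Labelling ℓ → Set
  StraightBelow c s T = StraightFrom (suc c) T × (∀ j → 0 < T j c → T j c < s → Kohnert T c j)

  -- Each swap gives the cell in row s a smaller label, so the recursion on the label bound n ends.
  -- It changes neither the columns right of c nor the cells of column c below row s.
  straighten-cell : ∀ n {T c s} → Tableau a T → StraightBelow c s T → 0 < s →
    ∀ j → T j c ≡ s → toℕ j < n → Relabelled T (StraightBelow c (suc s))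
  straighten-cell (suc n) {T} {c} tab (right , below) 0<s j refl (s≤s j≤n)
    with Fin.any? (λ i → toℕ i <? toℕ j ×-dec T j c <? T i c ×-dec T i (suc c) ≤? T j c)
  ... | no none = T , tab , (λ _ _ _ → id) , (λ _ _ _ → id) , right , below′
    where
    below′ : ∀ h → 0 < T h c → T h c < suc (T j c) → Kohnert T c h
    below′ h 0<h (s≤s h≤s) with m≤n⇒m<n∨m≡n h≤s
    ... | inj₁ h<s = below h 0<h h<s
    ... | inj₂ h≡s with refl ← Tableau.distinct tab h j 0<h h≡s =
      λ i i<j j<i → ≰⇒> λ fits → none (i , i<j , j<i , fits)
  ... | yes (i , i<j , j<i , fits) = relabelled-trans swapped-⊒ swapped-⊑
    (straighten-cell n swapped-tableau (right′ , below′) 0<s i swapped-i (≤-trans i<j j≤n))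
    where
    open Swap tab c i j i<j 0<s j<i fits
    swapped-i : swapped i c ≡ T j c
    swapped-i with transpose-cases i j i
    ... | inj₁ (_ , eq) = trans (swapped-c i) (cong (λ h → T h c) eq)
    ... | inj₂ (inj₁ (refl , _)) = contradiction refl (<⇒≢ i<j)
    ... | inj₂ (inj₂ (i≢i , _)) = contradiction refl i≢i
    swapped-j : swapped j c ≡ T i c
    swapped-j with transpose-cases i j j
    ... | inj₁ (refl , _) = contradiction refl (<⇒≢ i<j)
    ... | inj₂ (inj₁ (_ , eq)) = trans (swapped-c j) (cong (λ h → T h c) eq)
    ... | inj₂ (inj₂ (_ , j≢j , _)) = contradiction refl j≢j
    right′ : StraightFrom (suc c) swapped
    right′ x h c<x 0<h g g<h h<g =
      subst₂ _<_ (sym (swapped-right h c<x)) (sym (swapped-right g (m≤n⇒m≤1+n c<x)))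
        (right x h c<x (subst (0 <_) (swapped-right h c<x) 0<h) g g<h
          (subst₂ _<_ (swapped-right h c<x) (swapped-right g c<x) h<g))
    below′ : ∀ h → 0 < swapped h c → swapped h c < T j c → Kohnert swapped c h
    below′ h 0<h h<s with transpose-cases i j h
    ... | inj₁ (refl , _) = contradiction swapped-i (<⇒≢ h<s)
    ... | inj₂ (inj₁ (refl , _)) = contradiction (subst (_< T j c) swapped-j h<s) (<⇒≯ j<i)
    ... | inj₂ (inj₂ (_ , _ , eq)) = λ g g<h h<g →
      subst₂ _<_ (sym h≡) (sym (swapped-right g ≤-refl))
        (below h (subst (0 <_) h≡ 0<h) Th<s g g<h (above g (subst (_< swapped g c) h≡ h<g)))
      where
      h≡ : swapped h c ≡ T h c
      h≡ = trans (swapped-c h) (cong (λ x → T x c) eq)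
      Th<s : T h c < T j c
      Th<s = subst (_< T j c) h≡ h<s
      -- The two swapped cells both lie above the cell of h, before and after the swap.
      above : ∀ g → T h c < swapped g c → T h c < T g c
      above g h<g with transpose-cases i j g
      ... | inj₁ (refl , _) = <-trans Th<s j<i
      ... | inj₂ (inj₁ (refl , _)) = Th<s
      ... | inj₂ (inj₂ (_ , _ , eq)) = subst (T h c <_) (trans (swapped-c g) (cong (λ x → T x c) eq)) h<g

  straighten-column : ∀ s {T c} → Tableau a T → StraightFrom (suc c) T → Relabelled T (StraightBelow c (suc s))
  straighten-column zero {T} tab right = T , tab , (λ _ _ _ → id) , (λ _ _ _ → id) , right ,
    λ j 0<j j<1 → contradiction 0<j (<⇒≱ j<1)
  straighten-column (suc s) {T} {c} tab right with straighten-column s tab right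
  ... | T′ , tab′ , T⊑T′ , T′⊑T , straight@(right′ , below) with occupied? T′ c (suc s)
  ... | yes (j , Tj≡s) = relabelled-trans T⊑T′ T′⊑T (straighten-cell _ tab′ straight (s≤s z≤n) j Tj≡s ≤-refl)
  ... | no unocc = T′ , tab′ , T⊑T′ , T′⊑T , right′ ,
    λ j 0<j j<2+s → below j 0<j (≤∧≢⇒< (≤-pred j<2+s) λ eq → unocc (j , eq))

  straighten-from : ∀ n c {T} → sum a ≤ n + c → Tableau a T → Relabelled T (StraightFrom c)
  straighten-from zero c {T} N≤c tab = T , tab , (λ _ _ _ → id) , (λ _ _ _ → id) ,
    λ x j c≤x 0<j → contradiction (Tableau.present⁻¹ tab j 0<j)
      (≤⇒≯ (≤-trans (≤-trans (≤-sum a j) N≤c) c≤x))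
  straighten-from (suc n) c N≤n+c tab
    with straighten-from n (suc c) (≤-trans N≤n+c (≤-reflexive (sym (+-suc n c)))) tab
  ... | T′ , tab′ , T⊑T′ , T′⊑T , right with straighten-column ℓ tab′ right
  ... | T″ , tab″ , T′⊑T″ , T″⊑T′ , right″ , below = relabelled-trans T⊑T′ T′⊑T
    (T″ , tab″ , T′⊑T″ , T″⊑T′ , straight)
    where
    straight : StraightFrom c T″
    straight x j c≤x 0<j with m≤n⇒m<n∨m≡n c≤x
    ... | inj₁ c<x = right″ x j c<x 0<j
    ... | inj₂ refl = below j 0<j (s≤s (≤-trans (Tableau.bounded tab″ j c) (Fin.toℕ<n j)))

  straighten : ∀ {T} → Tableau a T → Relabelled T IsStraight
  straighten tab with straighten-from (sum a) 0 (m≤m+n _ 0) tab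
  ... | T′ , tab′ , T⊑T′ , T′⊑T , straight = T′ , tab′ , T⊑T′ , T′⊑T , λ x j → straight x j z≤n

-- From labellings back to quasi-Yamanouchi tableaux

module _ {ℓ} {a : Comp ℓ} where

  filling : Labelling ℓ → Filling a
  filling T i c = T i (toℕ c)

  filling-kohnert : ∀ {T} → Tableau a T → IsStraight T → IsKohnert a (filling T)
  filling-kohnert {T} tab straight = record
    { cellsDistinct = λ i j c d c≡d eq → distinct i j (present i (Fin.toℕ<n c))
        (trans eq (cong (T j) (sym c≡d)))
    ; rowPos = λ i c → present i (Fin.toℕ<n c)
    ; entry≥row = λ i c → bounded i (toℕ c)
    ; descend = λ i c d c<d → descend≤ i (<⇒≤ c<d)
    ; kohnert = kohnert
    }
    where
    open Tableau tab
    kohnert : ∀ i j (c : Fin (a i)) (d : Fin (a j)) → toℕ i < toℕ j → toℕ c ≡ toℕ d →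
      T j (toℕ d) < T i (toℕ c) → Σ (Fin (a i)) λ e → toℕ e ≡ suc (toℕ c) × T j (toℕ d) < T i (toℕ e)
    kohnert i j c d i<j c≡d j<i = fromℕ< 1+c<a , Fin.toℕ-fromℕ< 1+c<a ,
      subst (λ x → T j (toℕ d) < T i x) (sym (Fin.toℕ-fromℕ< 1+c<a)) j<i′
      where
      j<i′ : T j (toℕ d) < T i (suc (toℕ c))
      j<i′ = subst (λ x → T j (toℕ d) < T i (suc x)) (sym c≡d)
        (straight (toℕ d) j (present j (Fin.toℕ<n d)) i i<j (subst (λ x → T j (toℕ d) < T i x) c≡d j<i))
      1+c<a : suc (toℕ c) < a i
      1+c<a = present⁻¹ i (≤-<-trans z≤n j<i′)

  -- By induction every smaller row of the first column is taken by its own entry, so `bounded`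
  -- leaves only row `entry i`.
  first-column : Strong a → ∀ {T} → Tableau a T → ∀ n i → toℕ i < n → T i 0 ≡ entry i
  first-column strong {T} tab (suc n) i (s≤s i≤n) with m≤n⇒m<n∨m≡n (Tableau.bounded tab i 0)
  ... | inj₂ eq = eq
  ... | inj₁ lt with T i 0 in Ti | Tableau.present tab i (strong i)
  ... | suc r | _ = contradiction (Tableau.distinct tab k i (Tableau.present tab k (strong k)) Tk≡Ti)
      λ k≡i → <⇒≢ (≤-pred lt) (trans (sym (Fin.toℕ-fromℕ< r<ℓ)) (cong toℕ k≡i))
    where
    r<ℓ : r < ℓ
    r<ℓ = <-trans (≤-pred lt) (Fin.toℕ<n i)
    k : Fin ℓ
    k = fromℕ< r<ℓ
    Tk≡Ti : T k 0 ≡ T i 0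
    Tk≡Ti = trans (first-column strong tab n k (subst (_< n) (sym (Fin.toℕ-fromℕ< r<ℓ)) (≤-trans (≤-pred lt) i≤n)))
      (trans (cong suc (Fin.toℕ-fromℕ< r<ℓ)) (sym Ti))

  filling-QKT : Strong a → ∀ {T} → Tableau a T → IsStraight T → IsQKT a (filling T)
  filling-QKT strong {T} tab straight = record
    { kohnertTableau = filling-kohnert tab straight
    ; quasiYam = λ i c → inj₁ (own-row (T i (toℕ c)) (Tableau.present tab i (Fin.toℕ<n c))
        (≤-trans (Tableau.bounded tab i _) (Fin.toℕ<n i)))
    }
    where
    own-row : ∀ r → 0 < r → r ≤ ℓ → Σ (Fin ℓ) λ j → Σ (Fin (a j)) λ d → filling T j d ≡ r × entry j ≡ r
    own-row (suc r) _ r<ℓ = j , fromℕ< (strong j) ,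
      trans (cong (T j) (Fin.toℕ-fromℕ< (strong j))) (trans (first-column strong tab ℓ j (Fin.toℕ<n j)) j≡r) , j≡r
      where
      j = fromℕ< r<ℓ
      j≡r : entry j ≡ suc r
      j≡r = cong suc (Fin.toℕ-fromℕ< r<ℓ)

  open Straightening {ℓ} {a}

  -- Straightening preserves diagrams and hence row totals, so a counterexample need only satisfy
  -- (i)-(iii).
  equal-weights⇒not-multiplicityFree : Strong a → ∀ {T T′} → Tableau a T → Tableau a T′ →
    (∀ r → 0 < r → rowTotal (sum a) T r ≡ rowTotal (sum a) T′ r) →
    ∀ c r → 0 < r → Occupied T c r → ¬ Occupied T′ c r → ¬ MultiplicityFree a
  equal-weights⇒not-multiplicityFree strong tab tab′ total≡ c r 0<r occ unocc multFree
    with straighten tab | straighten tab′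
  ... | S , tabS , T⊑S , S⊑T , straightS | S′ , tabS′ , T′⊑S′ , S′⊑T′ , straightS′
    with T⊑S c r 0<r occ
  ... | i , Si≡r = unocc (S′⊑T′ c r 0<r (i , trans (sym S≡S′) Si≡r))
    where
    weight : ∀ {S T} → Tableau a S → Tableau a T → S ⊑ T → T ⊑ S →
      ∀ k → rowCount a (filling S) (entry {ℓ} k) ≡ rowTotal (sum a) T (entry k)
    weight tabS tab S⊑T T⊑S k = trans (rowCount≡rowTotal tabS _ (λ _ _ → refl) _ (s≤s z≤n))
      (rowTotal-cong tabS tab S⊑T T⊑S (sum a) _ (s≤s z≤n))
    wt≡ : ∀ k → wt a (filling S) k ≡ wt a (filling S′) k
    wt≡ k = trans (weight tabS tab S⊑T T⊑S k)
      (trans (total≡ _ (s≤s z≤n)) (sym (weight tabS′ tab′ S′⊑T′ T′⊑S′ k)))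
    c<a : c < a i
    c<a = Tableau.present⁻¹ tabS i (subst (0 <_) (sym Si≡r) 0<r)
    S≡S′ : S i c ≡ S′ i c
    S≡S′ = subst (λ x → S i x ≡ S′ i x) (Fin.toℕ-fromℕ< c<a)
      (multFree (filling S) (filling S′) (filling-QKT strong tabS straightS)
        (filling-QKT strong tabS′ straightS′) wt≡ i (fromℕ< c<a))

-- Moving single cells

sum-change : ∀ {n} (f g : Fin n → ℕ) i → (∀ j → j ≢ i → f j ≡ g j) → sum f + g i ≡ sum g + f i
sum-change {suc n} f g zero off rewrite sum-cong-≗ {n} (λ j → off (suc j) λ ()) =
  solve (f zero) (g zero) (sum (g ∘ suc))
  where
  solve : ∀ x y z → (x + z) + y ≡ (y + z) + x
  solve = solve-∀
sum-change {suc n} f g (suc i) off rewrite off zero (λ ()) =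
  trans (+-assoc (g zero) _ _) (trans (cong (g zero +_)
    (sum-change (f ∘ suc) (g ∘ suc) i λ j j≢i → off (suc j) (j≢i ∘ Fin.suc-injective)))
    (sym (+-assoc (g zero) _ _)))

module _ {ℓ : ℕ} where

  move : Labelling ℓ → Fin ℓ → ℕ → ℕ → Labelling ℓ
  move T i c v g x with g Fin.≟ i | x ≟ c
  ... | yes _ | yes _ = v
  ... | _ | _ = T g x

  move-here : ∀ (T : Labelling ℓ) i c v → move T i c v i c ≡ v
  move-here T i c v with i Fin.≟ i | c ≟ c
  ... | yes _ | yes _ = refl
  ... | yes _ | no c≢c = contradiction refl c≢c
  ... | no i≢i | _ = contradiction refl i≢i

  move-label : ∀ (T : Labelling ℓ) i c v {g} x → g ≢ i → move T i c v g x ≡ T g x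
  move-label T i c v {g} x g≢i with g Fin.≟ i | x ≟ c
  ... | yes g≡i | _ = contradiction g≡i g≢i
  ... | no _ | yes _ = refl
  ... | no _ | no _ = refl

  move-column : ∀ (T : Labelling ℓ) i c v g {x} → x ≢ c → move T i c v g x ≡ T g x
  move-column T i c v g {x} x≢c with g Fin.≟ i | x ≟ c
  ... | _ | yes x≡c = contradiction x≡c x≢c
  ... | yes _ | no _ = refl
  ... | no _ | no _ = refl

  move-free-column : ∀ {T : Labelling ℓ} i c v {x w} → x ≢ c → ¬ Occupied T x w → ¬ Occupied (move T i c v) x w
  move-free-column {T} i c v x≢c free (g , eq) = free (g , trans (sym (move-column T i c v g x≢c)) eq)

  move-free-row : ∀ {T : Labelling ℓ} i c v {x w} → v ≢ w → ¬ Occupied T x w → ¬ Occupied (move T i c v) x w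
  move-free-row i c v {x} v≢w free (g , eq) with g Fin.≟ i | x ≟ c
  ... | yes _ | yes _ = v≢w eq
  ... | yes _ | no _ = free (g , eq)
  ... | no _ | yes _ = free (g , eq)
  ... | no _ | no _ = free (g , eq)

  rowTotal-move : ∀ (T : Labelling ℓ) i c v {u} N → c < N → T i c ≡ u → ∀ r →
    rowTotal N (move T i c v) r + δ u r ≡ rowTotal N T r + δ v r
  rowTotal-move T i c v {u} N c<N Ti≡u r =
    +-cancelʳ-≡ (part T i + part (move T i c v) i) _ _
      (trans (lhs (rowTotal N (move T i c v) r) (part (move T i c v) i) (part T i) (δ u r))
        (trans (cong₂ _+_ outer (sym inner))
          (rhs (rowTotal N T r) (δ v r) (part (move T i c v) i) (part T i))))
    where
    part : Labelling ℓ → Fin ℓ → ℕ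
    part T g = ∑[ x < N ] δ (T g (toℕ x)) r
    outer : rowTotal N (move T i c v) r + part T i ≡ rowTotal N T r + part (move T i c v) i
    outer = sum-change (part (move T i c v)) (part T) i λ g g≢i →
      sum-cong-≗ {N} λ x → cong (λ y → δ y r) (move-label T i c v (toℕ x) g≢i)
    inner : part T i + δ v r ≡ part (move T i c v) i + δ u r
    inner = sym (subst₂ (λ s t → part (move T i c v) i + δ s r ≡ part T i + δ t r)
      (trans (cong (T i) (Fin.toℕ-fromℕ< c<N)) Ti≡u)
      (trans (cong (move T i c v i) (Fin.toℕ-fromℕ< c<N)) (move-here T i c v))
      (sum-change (λ x → δ (move T i c v i (toℕ x)) r) (λ x → δ (T i (toℕ x)) r) (fromℕ< c<N)
        λ x x≢c → cong (λ y → δ y r) (move-column T i c v i λ eq →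
          x≢c (Fin.toℕ-injective (trans eq (sym (Fin.toℕ-fromℕ< c<N)))))))
    lhs : ∀ m p q d → (m + d) + (q + p) ≡ (m + q) + (p + d)
    lhs = solve-∀
    rhs : ∀ m d q p → (m + q) + (p + d) ≡ (m + d) + (p + q)
    rhs = solve-∀

  keyLabelling : Comp ℓ → Labelling ℓ
  keyLabelling a i c with c <? a i
  ... | yes _ = entry i
  ... | no _ = 0

module _ {ℓ} {a : Comp ℓ} where

  move-vacates : ∀ {T} → Tableau a T → ∀ i c v {w} → T i c ≡ w → 0 < w → v ≢ w →
    ¬ Occupied (move T i c v) c w
  move-vacates {T} tab i c v Ti≡w 0<w v≢w (g , eq) with g Fin.≟ i | c ≟ c
  ... | _ | no c≢c = c≢c refl
  ... | yes _ | yes _ = v≢w eq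
  ... | no g≢i | yes _ = g≢i (Tableau.distinct tab g i (subst (0 <_) (sym eq) 0<w) (trans eq (sym Ti≡w)))

  -- Moving down respects the descent from the left and the bound by the label; at stake are the
  -- descent to the right and a free target cell.
  move-tableau : ∀ {T} → Tableau a T → ∀ i c v → c < a i → 0 < v → v ≤ T i c → T i (suc c) ≤ v →
    ¬ Occupied T c v → Tableau a (move T i c v)
  move-tableau {T} tab i c v c<a 0<v v≤T T≤v free = record
    { absent = absent′
    ; present = present′
    ; distinct = distinct′
    ; bounded = bounded′
    ; descend = descend′
    }
    where
    open Tableau tab
    absent′ : ∀ g {x} → a g ≤ x → move T i c v g x ≡ 0
    absent′ g {x} a≤x with g Fin.≟ i | x ≟ c
    ... | yes refl | yes refl = contradiction a≤x (<⇒≱ c<a)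
    ... | yes _ | no _ = absent g a≤x
    ... | no _ | yes _ = absent g a≤x
    ... | no _ | no _ = absent g a≤x
    present′ : ∀ g {x} → x < a g → 0 < move T i c v g x
    present′ g {x} x<a with g Fin.≟ i | x ≟ c
    ... | yes _ | yes _ = 0<v
    ... | yes _ | no _ = present g x<a
    ... | no _ | yes _ = present g x<a
    ... | no _ | no _ = present g x<a
    distinct′ : ∀ g h {x} → 0 < move T i c v g x → move T i c v g x ≡ move T i c v h x → g ≡ h
    distinct′ g h {x} 0<g eq with g Fin.≟ i | h Fin.≟ i | x ≟ c
    ... | yes refl | yes refl | _ = refl
    ... | yes _ | no _ | yes refl = contradiction (h , sym eq) free
    ... | no _ | yes _ | yes refl = contradiction (g , eq) free
    ... | no _ | no _ | yes _ = distinct g h 0<g eq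
    ... | yes _ | no _ | no _ = distinct g h 0<g eq
    ... | no _ | yes _ | no _ = distinct g h 0<g eq
    ... | no _ | no _ | no _ = distinct g h 0<g eq
    bounded′ : ∀ g x → move T i c v g x ≤ entry g
    bounded′ g x with g Fin.≟ i | x ≟ c
    ... | yes refl | yes refl = ≤-trans v≤T (bounded i c)
    ... | yes _ | no _ = bounded g x
    ... | no _ | yes _ = bounded g x
    ... | no _ | no _ = bounded g x
    descend′ : ∀ g x → move T i c v g (suc x) ≤ move T i c v g x
    descend′ g x with g Fin.≟ i | suc x ≟ c | x ≟ c
    ... | yes refl | yes refl | yes 1+x≡x = contradiction (sym 1+x≡x) 1+n≢n
    ... | yes refl | yes refl | no _ = ≤-trans v≤T (descend g x)
    ... | yes refl | no _ | yes refl = T≤v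
    ... | yes refl | no _ | no _ = descend g x
    ... | no _ | yes _ | yes _ = descend g x
    ... | no _ | yes _ | no _ = descend g x
    ... | no _ | no _ | yes _ = descend g x
    ... | no _ | no _ | no _ = descend g x

  key-present : ∀ i {c} → c < a i → keyLabelling a i c ≡ entry i
  key-present i {c} c<a with c <? a i
  ... | yes _ = refl
  ... | no c≮a = contradiction c<a c≮a

  key-free : ∀ i {c} → a i ≤ c → ¬ Occupied (keyLabelling a) c (entry i)
  key-free i {c} a≤c (g , eq) with c <? a g
  ... | yes c<a with refl ← Fin.toℕ-injective (suc-injective eq) = contradiction a≤c (<⇒≱ c<a)

  key-tableau : Tableau a (keyLabelling a)
  key-tableau = record
    { absent = absent′
    ; present = λ i c<a → subst (0 <_) (sym (key-present i c<a)) (s≤s z≤n)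
    ; distinct = distinct′
    ; bounded = bounded′
    ; descend = descend′
    }
    where
    absent′ : ∀ i {c} → a i ≤ c → keyLabelling a i c ≡ 0
    absent′ i {c} a≤c with c <? a i
    ... | yes c<a = contradiction a≤c (<⇒≱ c<a)
    ... | no _ = refl
    distinct′ : ∀ i j {c} → 0 < keyLabelling a i c → keyLabelling a i c ≡ keyLabelling a j c → i ≡ j
    distinct′ i j {c} 0<i eq with c <? a i | c <? a j
    ... | yes _ | yes _ = Fin.toℕ-injective (suc-injective eq)
    bounded′ : ∀ i c → keyLabelling a i c ≤ entry i
    bounded′ i c with c <? a i
    ... | yes _ = ≤-refl
    ... | no _ = z≤n
    descend′ : ∀ i c → keyLabelling a i (suc c) ≤ keyLabelling a i c
    descend′ i c with suc c <? a i | c <? a i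
    ... | no _ | _ = z≤n
    ... | yes _ | yes _ = ≤-refl
    ... | yes 1+c<a | no c≮a = contradiction (<-trans (n<1+n c) 1+c<a) c≮a

-- Each pattern yields two diagrams of equal weight

last-column : ∀ {m n} → m < n → ∃ λ c → n ≡ suc c × m ≤ c
last-column (s≤s m≤c) = _ , refl , m≤c

module MultiplicityFree⇒avoiding {ℓ} {a : Comp ℓ} (strong : Strong a) (multFree : MultiplicityFree a) where

  private
    K = keyLabelling a
    N = sum a

    <N : ∀ i {c} → a i ≡ suc c → c < N
    <N i eq = ≤-trans (≤-reflexive (sym eq)) (≤-sum a i)

    in-last : ∀ i {c} → a i ≡ suc c → c < a i
    in-last i eq = ≤-reflexive (sym eq)

    entry≤ : ∀ {i j : Fin ℓ} → toℕ i < toℕ j → ∀ {x} → x ≡ entry j → entry i ≤ x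
    entry≤ i<j eq = subst (_ ≤_) (sym eq) (s≤s (<⇒≤ i<j))

    entry-≢ : ∀ {i j : Fin ℓ} → toℕ i < toℕ j → entry i ≢ entry j
    entry-≢ i<j eq = <⇒≢ i<j (suc-injective eq)

    label-≢ : ∀ {i j : Fin ℓ} → toℕ i < toℕ j → j ≢ i
    label-≢ i<j refl = <-irrefl refl i<j

    shorten : ∀ {T} → Tableau a T → ∀ i {c v} → a i ≡ suc c → 0 < v → v ≤ T i c → ¬ Occupied T c v →
      Tableau a (move T i c v)
    shorten {T} tab i {c} {v} eq 0<v v≤T free = move-tableau tab i c v (in-last i eq) 0<v v≤T
      (≤-trans (≤-reflexive (Tableau.absent tab i (≤-reflexive eq))) z≤n) free

  condA : CondA a
  condA (i , j , k , i<j , j<k , ai<aj , aj<ak) with last-column ai<aj | last-column aj<ak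
  ... | C , aj≡1+C , ai≤C | D , ak≡1+D , aj≤D =
    equal-weights⇒not-multiplicityFree strong tab₁ tab₂ (λ r _ → total≡ r) C (entry i) (s≤s z≤n)
      (j , trans (move-column M k D (entry j) j C≢D) (move-here K j C (entry i)))
      (move-free-column k D (entry i) C≢D (key-free i ai≤C)) multFree
    where
    C<D : C < D
    C<D = subst (_≤ D) aj≡1+C aj≤D
    C≢D : C ≢ D
    C≢D = <⇒≢ C<D
    Kj : K j C ≡ entry j
    Kj = key-present j (in-last j aj≡1+C)
    Kk : K k D ≡ entry k
    Kk = key-present k (in-last k ak≡1+D)
    M = move K j C (entry i)
    Mk : M k D ≡ entry k
    Mk = trans (move-label K j C (entry i) D (label-≢ j<k)) Kk
    T₁ = move M k D (entry j)
    T₂ = move K k D (entry i)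
    tabM : Tableau a M
    tabM = shorten key-tableau j aj≡1+C (s≤s z≤n) (entry≤ i<j Kj) (key-free i ai≤C)
    tab₁ : Tableau a T₁
    tab₁ = shorten tabM k ak≡1+D (s≤s z≤n) (entry≤ j<k Mk)
      (move-free-column j C (entry i) (≢-sym C≢D) (key-free j aj≤D))
    tab₂ : Tableau a T₂
    tab₂ = shorten key-tableau k ak≡1+D (s≤s z≤n) (entry≤ (<-trans i<j j<k) Kk)
      (key-free i (≤-trans ai≤C (<⇒≤ C<D)))
    -- In `T₁` row j loses one cell and gains one, so both tableaux move one cell from row k to row
    -- i in total.
    total≡ : ∀ r → rowTotal N T₁ r ≡ rowTotal N T₂ r
    total≡ r = +-cancelʳ-≡ (δ (entry k) r) _ _ (trans
      (rowTotal-move M k D (entry j) N (<N k ak≡1+D) Mk r) (trans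
      (rowTotal-move K j C (entry i) N (<N j aj≡1+C) Kj r)
      (sym (rowTotal-move K k D (entry i) N (<N k ak≡1+D) Kk r))))

  condB : CondB a
  condB (i , j , k , l , i<j , j<k , k<l , ai<al , aj<al , al<ak)
    with last-column ai<al | last-column al<ak
  ... | C , al≡1+C , ai≤C | D , ak≡1+D , al≤D =
    equal-weights⇒not-multiplicityFree strong (tab i j i<k j<k ai≤C aj≤D) (tab j i j<k i<k aj≤C ai≤D)
      (λ r _ → total≡ r) C (entry i) (s≤s z≤n)
      (l , trans (move-column (M i) k D (entry j) l C≢D) (move-here K l C (entry i)))
      (move-free-column k D (entry i) C≢D (move-free-row l C (entry j) (≢-sym (entry-≢ i<j)) (key-free i ai≤C)))
      multFree
    where
    C<D : C < D
    C<D = subst (_≤ D) al≡1+C al≤D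
    C≢D : C ≢ D
    C≢D = <⇒≢ C<D
    aj≤C : a j ≤ C
    aj≤C = ≤-pred (subst (a j <_) al≡1+C aj<al)
    ai≤D : a i ≤ D
    ai≤D = ≤-trans ai≤C (<⇒≤ C<D)
    aj≤D : a j ≤ D
    aj≤D = ≤-trans aj≤C (<⇒≤ C<D)
    i<k : toℕ i < toℕ k
    i<k = <-trans i<j j<k
    Kl : K l C ≡ entry l
    Kl = key-present l (in-last l al≡1+C)
    M : Fin ℓ → Labelling ℓ
    M x = move K l C (entry x)
    T : Fin ℓ → Fin ℓ → Labelling ℓ
    T x y = move (M x) k D (entry y)
    Mk : ∀ x → M x k D ≡ entry k
    Mk x = trans (move-column K l C (entry x) k (≢-sym C≢D)) (key-present k (in-last k ak≡1+D))
    tab : ∀ x y → toℕ x < toℕ k → toℕ y < toℕ k → a x ≤ C → a y ≤ D → Tableau a (T x y)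
    tab x y x<k y<k ax≤C ay≤D = shorten
      (shorten key-tableau l al≡1+C (s≤s z≤n) (entry≤ (<-trans x<k k<l) Kl) (key-free x ax≤C))
      k ak≡1+D (s≤s z≤n) (entry≤ y<k (Mk x)) (move-free-column l C (entry x) (≢-sym C≢D) (key-free y ay≤D))
    -- The right-hand side is symmetric in x and y, so `T i j` and `T j i` have equal row totals.
    total : ∀ x y r → rowTotal N (T x y) r + (δ (entry k) r + δ (entry l) r)
      ≡ rowTotal N K r + (δ (entry x) r + δ (entry y) r)
    total x y r = combine (rowTotal N (T x y) r) (rowTotal N (M x) r) (rowTotal N K r)
      (δ (entry k) r) (δ (entry l) r) (δ (entry x) r) (δ (entry y) r)
      (rowTotal-move (M x) k D (entry y) N (<N k ak≡1+D) (Mk x) r)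
      (rowTotal-move K l C (entry x) N (<N l al≡1+C) Kl r)
      where
      combine : ∀ t m b k l x y → t + k ≡ m + y → m + l ≡ b + x → t + (k + l) ≡ b + (x + y)
      combine t m b k l x y p q = trans (sym (+-assoc t k l)) (trans (cong (_+ l) p)
        (trans (reorder m y l) (trans (cong (_+ y) q) (+-assoc b x y))))
        where
        reorder : ∀ m y l → (m + y) + l ≡ (m + l) + y
        reorder = solve-∀
    total≡ : ∀ r → rowTotal N (T i j) r ≡ rowTotal N (T j i) r
    total≡ r = +-cancelʳ-≡ (δ (entry k) r + δ (entry l) r) _ _ (trans (total i j r)
      (trans (cong (rowTotal N K r +_) (+-comm (δ (entry i) r) _)) (sym (total j i r))))

  condC : CondC a
  condC (i , j , k , l , i<j , j<k , k<l , ai<ak , aj+1<ak , ak≡al)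
    with last-column ai<ak | last-column aj+1<ak
  ... | C , ak≡1+C , ai≤C | _ , ak≡1+C′ , aj+1≤C
    with refl ← suc-injective (trans (sym ak≡1+C) ak≡1+C′)
    -- B is the next-to-last column of k; the gap of two in (c) says that j does not reach it.
    with last-column (≤-trans (≤-reflexive (+-comm 1 (a j))) aj+1≤C)
  ... | B , refl , aj≤B =
    equal-weights⇒not-multiplicityFree strong tab₁ tab₂ (λ r _ → total≡ r) B (entry j) (s≤s z≤n)
      (k , trans (move-label M′ l C (entry k) B (≢-sym (label-≢ k<l))) (move-here M k B (entry j)))
      (move-free-column l C (entry j) B≢C (move-free-column k C (entry i) B≢C (key-free j aj≤B)))
      multFree
    where
    B≢C : B ≢ C
    B≢C = <⇒≢ ≤-refl
    al≡1+C : a l ≡ suc C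
    al≡1+C = trans (sym ak≡al) ak≡1+C
    B<ak : B < a k
    B<ak = <-trans ≤-refl (in-last k ak≡1+C)
    i<k : toℕ i < toℕ k
    i<k = <-trans i<j j<k
    Kk : K k C ≡ entry k
    Kk = key-present k (in-last k ak≡1+C)
    Kl : K l C ≡ entry l
    Kl = key-present l (in-last l al≡1+C)
    M = move K k C (entry i)
    Mk : M k B ≡ entry k
    Mk = trans (move-column K k C (entry i) k B≢C) (key-present k B<ak)
    Ml : M l C ≡ entry l
    Ml = trans (move-label K k C (entry i) C (label-≢ k<l)) Kl
    M′ = move M k B (entry j)
    M′l : M′ l C ≡ entry l
    M′l = trans (move-label M k B (entry j) C (label-≢ k<l)) Ml
    T₁ = move M′ l C (entry k)
    T₂ = move M l C (entry j)
    tabM : Tableau a M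
    tabM = shorten key-tableau k ak≡1+C (s≤s z≤n) (entry≤ i<k Kk) (key-free i ai≤C)
    tabM′ : Tableau a M′
    tabM′ = move-tableau tabM k B (entry j) B<ak (s≤s z≤n) (entry≤ j<k Mk)
      (≤-trans (≤-reflexive (move-here K k C (entry i))) (s≤s (<⇒≤ i<j)))
      (move-free-column k C (entry i) B≢C (key-free j aj≤B))
    tab₁ : Tableau a T₁
    tab₁ = shorten tabM′ l al≡1+C (s≤s z≤n) (entry≤ k<l M′l)
      -- Row k is free in the last column because `M` has moved the cell of k there to row i.
      (move-free-column k B (entry j) (≢-sym B≢C)
        (move-vacates key-tableau k C (entry i) Kk (s≤s z≤n) (entry-≢ i<k)))
    tab₂ : Tableau a T₂
    tab₂ = shorten tabM l al≡1+C (s≤s z≤n) (entry≤ (<-trans j<k k<l) Ml)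
      (move-free-row k C (entry i) (entry-≢ i<j) (key-free j (m≤n⇒m≤1+n aj≤B)))
    -- After the common move `M`, the steps from k to j and from l to k amount to one from l to j.
    total≡ : ∀ r → rowTotal N T₁ r ≡ rowTotal N T₂ r
    total≡ r = +-cancelʳ-≡ (δ (entry l) r) _ _ (trans
      (rowTotal-move M′ l C (entry k) N (<N l al≡1+C) M′l r) (trans
      (rowTotal-move M k B (entry j) N (<-trans ≤-refl (<N k ak≡1+C)) Mk r)
      (sym (rowTotal-move M l C (entry j) N (<N l al≡1+C) Ml r))))

theorem4p3 : ∀ (ℓ : ℕ) (α : Comp ℓ) → Strong α →
    (MultiplicityFree α ⇔ (CondA α × CondB α × CondC α))
theorem4p3 ℓ α strong = mk⇔
  (λ multFree → let open MultiplicityFree⇒avoiding strong multFree in condA , condB , condC)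
  avoiding⇒multiplicityFree
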